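{- For every $\boldsymbol{\Delta}^0_2$ set $A\subseteq2^\omega$ there is a set $B\subseteq2^\omega$ with $B\equiv_W A$ such that $B$ is dualistic and $B=\Phi(C)=\Phi(U)$ for some closed set $C$ and some open set $U$.
   Context: $2^\omega$ is the Cantor space; $N_s=\{x:s\subset x\}$; $\mu$ the coin-tossing measure with $\mu(N_s)=2^{ -\mathrm{lh}(s)}$. For measurable $A$ and $x\in2^\omega$, the density of $x$ in $A$ is $\mathcal D_A(x)=\lim_n\mu(A\cap N_{x\restriction n})/\mu(N_{x\restriction n})$ when the limit exists; $\Phi(A)=\{x:\mathcal D_A(x)=1\}$. A measurable set $B$ is dualistic if for every $x\in2^\omega$, $\mathcal D_B(x)$ exists and equals $0$ or $1$. $\boldsymbol{\Delta}^0_2$: sets both $F_\sigma$ and $G_\delta$. $X\equiv_W Y$ iff each is the preimage of the other under some continuous map $2^\omega\to2^\omega$. -}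

module Defs where

open import Level using (0ℓ)
open import Data.Bool.Base using (Bool)
open import Data.List.Base using (List; length; foldr; applyUpTo)
open import Data.Nat.Base as ℕ using (ℕ; zero; suc)
open import Data.Product.Base using (Σ-syntax; ∃-syntax; _×_)
open import Data.Rational.Base using (ℚ; 0ℚ; 1ℚ; ½; _+_; _-_; _*_; _<_; _≤_)
open import Data.Sum.Base using (_⊎_)
open import Relation.Binary.PropositionalEquality.Core using (_≡_)
open import Relation.Unary using (Pred; _∈_; _∉_; _⊆_; _≐_; _∩_; ∁; ⋃; ⋂; _⊢_)

-- Points of 2^ω are compared only through their finite restrictions, so no
-- function extensionality is needed: open sets and (classically) closed sets do
-- not distinguish pointwise equal sequences, hence neither do Δ⁰₂ sets nor sets
-- Wadge equivalent to them.

2^ω : Set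
2^ω = ℕ → Bool

Subset : Set₁
Subset = Pred 2^ω 0ℓ

_↾_ : 2^ω → ℕ → List Bool
x ↾ n = applyUpTo x n

N : List Bool → Subset
N s x = x ↾ length s ≡ s

Open : Subset → Set
Open U = ∀ {x} → x ∈ U → ∃[ n ] N (x ↾ n) ⊆ U

Closed : Subset → Set
Closed C = Open (∁ C)

Fσ : Subset → Set₁
Fσ A = Σ[ F ∈ (ℕ → Subset) ] (∀ n → Closed (F n)) × A ≐ ⋃ ℕ F

Gδ : Subset → Set₁
Gδ A = Σ[ G ∈ (ℕ → Subset) ] (∀ n → Open (G n)) × A ≐ ⋂ ℕ G

Δ⁰₂ : Subset → Set₁
Δ⁰₂ A = Fσ A × Gδ A

Continuous : (2^ω → 2^ω) → Set₁
Continuous f = ∀ {U : Subset} → Open U → Open (f ⊢ U)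

infix 4 _≤W_ _≡W_

_≤W_ : Subset → Subset → Set₁
X ≤W Y = Σ[ f ∈ (2^ω → 2^ω) ] Continuous f × X ≐ (f ⊢ Y)

_≡W_ : Subset → Subset → Set₁
X ≡W Y = X ≤W Y × Y ≤W X

-- A real number α is represented by its upper cut, the set of rationals q
-- with α < q.

Cut : Set₁
Cut = Pred ℚ 0ℓ

infix 4 _<ʳ_ _ʳ<_

_ʳ<_ : Cut → ℚ → Set
α ʳ< q = q ∈ α

-- The strict inequality p < α needs some q > p outside the cut, since
-- p ∉ α only says p ≤ α.
_<ʳ_ : ℚ → Cut → Set
p <ʳ α = ∃[ q ] p < q × q ∉ α

_⟶_ : (ℕ → Cut) → ℚ → Set
α ⟶ l = ∀ (ε : ℚ) → 0ℚ < ε →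
  ∃[ m ] (∀ n → m ℕ.≤ n → (l - ε <ʳ α n) × (α n ʳ< l + ε))

2⁻_ : ℕ → ℚ
2⁻ zero  = 1ℚ
2⁻ suc n = ½ * 2⁻ n

∑< : ℕ → (ℕ → ℚ) → ℚ
∑< n a = foldr _+_ 0ℚ (applyUpTo a n)

-- The outer measure inf { Σᵢ 2^{-lh(sᵢ)} : A ⊆ ⋃ᵢ N_{sᵢ} }; on measurable
-- sets it is the coin-tossing measure.  Since all terms are positive, the sum
-- of a series is < q exactly when some r < q bounds all its partial sums.
μ : Subset → Cut
μ A q = Σ[ s ∈ (ℕ → List Bool) ]
  A ⊆ ⋃ ℕ (λ i → N (s i)) ×
  ∃[ r ] r < q × (∀ n → ∑< n (λ i → 2⁻ length (s i)) ≤ r)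

Null : Subset → Set
Null A = ∀ (ε : ℚ) → 0ℚ < ε → μ A ʳ< ε

-- The σ-algebra generated by the open sets and the null sets, that is, the
-- completion of the Borel σ-algebra with respect to μ.
data Measurable : Subset → Set₁ where
  fromOpen   : ∀ {U} → Open U → Measurable U
  fromNull   : ∀ {A} → Null A → Measurable A
  complement : ∀ {A} → Measurable A → Measurable (∁ A)
  union      : ∀ {A : ℕ → Subset} → (∀ n → Measurable (A n)) → Measurable (⋃ ℕ A)
  resp-≐     : ∀ {A B} → A ≐ B → Measurable A → Measurable B

-- The ratio μ(A ∩ N_{x↾n}) / μ(N_{x↾n}), where μ(N_{x↾n}) = 2⁻ⁿ: the quotient
-- α / 2⁻ⁿ is below q exactly when α is below q · 2⁻ⁿ.
localMeasure : Subset → 2^ω → ℕ → Cut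
localMeasure A x n q = μ (A ∩ N (x ↾ n)) ʳ< q * 2⁻ n

-- The limit defining the density of x in A exists and equals l.
HasDensity : Subset → 2^ω → ℚ → Set
HasDensity A x l = localMeasure A x ⟶ l

Φ : Subset → Subset
Φ A x = HasDensity A x 1ℚ

Dualistic : Subset → Set₁
Dualistic B = Measurable B × (∀ x → HasDensity B x 0ℚ ⊎ HasDensity B x 1ℚ)

{-# OPTIONS --safe #-}
module Submission where

-- Closed sets E₀, E₁, … covering 2^ω, each inside A or inside its complement,
-- give points z(s) ∈ N_s such that z(x↾m) ∈ A ⇔ x ∈ A for all large m: let
-- z(s) be a point of N_s ∩ E_i with i least.  Cut ω into blocks, the m-th one
-- a coding position followed by m padding positions.  Let g(y) be the point x
-- read off y at the coding positions if all padding of y is 0, and z(x↾m) if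
-- the first nonzero padding lies in block m; take B = g⁻¹(A).  The sets
-- U = {y ∈ B : some padding is nonzero} and ∁C = {y ∉ B : some padding is
-- nonzero} are open and U ⊆ B ⊆ C.  If y has zero padding and z(x↾m) is on the
-- same side as x for m ≥ l, then near y the points outside the corresponding
-- open set have zero padding throughout the next two blocks, so their relative
-- measure tends to 0.

open import Defs
open import Level using (0ℓ)
open import Axiom.ExcludedMiddle using (ExcludedMiddle)
open import Data.Bool.Base using (Bool; true; false)
open import Data.Bool.Properties using (¬-not)
open import Data.Integer.Base as ℤ using (+[1+_])
open import Data.List.Base using (List; []; _∷_; _∷ʳ_; length)
open import Data.List.Properties using (length-applyUpTo; applyUpTo-∷ʳ; ∷-injective)
open import Data.Nat.Base as ℕ using (ℕ; zero; suc; z≤n; s≤s)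
open import Data.Nat.Properties as ℕ using ()
open import Data.Product.Base using (Σ-syntax; ∃-syntax; _×_; _,_; proj₁; proj₂; map; map₁; map₂)
open import Data.Rational.Base as ℚ using (ℚ; mkℚ; 0ℚ; 1ℚ; ½; _+_; _-_; _*_; _<_; _≤_; Positive; toℚᵘ)
open import Data.Rational.Properties as ℚ using ()
open import Data.Rational.Solver using (module +-*-Solver)
open import Data.Rational.Unnormalised.Base as ℚᵘ using (mkℚᵘ; *≤*; *<*)
open import Data.Rational.Unnormalised.Properties as ℚᵘ using ()
open import Data.Sum.Base using (_⊎_; inj₁; inj₂)
open import Function.Base using (_∘_; const; id)
open import Relation.Binary.Definitions using (tri<; tri≈; tri>)
open import Relation.Binary.PropositionalEquality
open import Relation.Nullary using (¬_; yes; no; contradiction)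
open import Relation.Nullary.Decidable using (decidable-stable)
open import Relation.Unary using (Pred; _∈_; _∉_; _⊆_; _≐_; _∩_; ∁; ⋃; _⊢_)

-- Powers of ½ and finite sums

½p+½p≡p : ∀ p → ½ * p + ½ * p ≡ p
½p+½p≡p p = trans (sym (ℚ.*-distribʳ-+ p ½ ½)) (ℚ.*-identityˡ p)

2⁻-positive : ∀ n → Positive (2⁻ n)
2⁻-positive zero    = _
2⁻-positive (suc n) = ℚ.pos*pos⇒pos ½ (2⁻ n) ⦃ 2⁻-positive n ⦄

0<2⁻ : ∀ n → 0ℚ < 2⁻ n
0<2⁻ n = ℚ.positive⁻¹ (2⁻ n) ⦃ 2⁻-positive n ⦄

2⁻-antitone : ∀ {m n} → m ℕ.≤ n → 2⁻ n ≤ 2⁻ m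
2⁻-antitone {m} {n} m≤n with ℕ.m≤n⇒∃[o]m+o≡n m≤n
... | o , refl = go o m
  where
  step : ∀ p → 0ℚ ≤ p → ½ * p ≤ p
  step p 0≤p = begin
    ½ * p          ≡⟨ ℚ.+-identityʳ (½ * p) ⟨
    ½ * p + 0ℚ     ≤⟨ ℚ.+-monoʳ-≤ (½ * p) (ℚ.*-monoˡ-≤-nonNeg ½ 0≤p) ⟩
    ½ * p + ½ * p  ≡⟨ ½p+½p≡p p ⟩
    p              ∎
    where open ℚ.≤-Reasoning
  go : ∀ o m → 2⁻ (m ℕ.+ o) ≤ 2⁻ m
  go zero    m = ℚ.≤-reflexive (cong 2⁻_ (ℕ.+-identityʳ m))
  go (suc o) m rewrite ℕ.+-suc m o =
    ℚ.≤-trans (step (2⁻ (m ℕ.+ o)) (ℚ.<⇒≤ (0<2⁻ (m ℕ.+ o)))) (go o m)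

2⁻-+ : ∀ m n → 2⁻ (m ℕ.+ n) ≡ 2⁻ m * 2⁻ n
2⁻-+ zero    n = sym (ℚ.*-identityˡ (2⁻ n))
2⁻-+ (suc m) n = trans (cong (½ *_) (2⁻-+ m n)) (sym (ℚ.*-assoc ½ (2⁻ m) (2⁻ n)))

2⁻≤1/suc : ∀ k → toℚᵘ (2⁻ k) ℚᵘ.≤ mkℚᵘ (ℤ.+ 1) k
2⁻≤1/suc zero    = ℚᵘ.≤-refl
2⁻≤1/suc (suc k) = begin
  toℚᵘ (½ * 2⁻ k)              ≃⟨ ℚ.toℚᵘ-homo-* ½ (2⁻ k) ⟩
  toℚᵘ ½ ℚᵘ.* toℚᵘ (2⁻ k)      ≤⟨ ℚᵘ.*-monoʳ-≤-nonNeg (toℚᵘ ½) (2⁻≤1/suc k) ⟩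
  toℚᵘ ½ ℚᵘ.* mkℚᵘ (ℤ.+ 1) k     ≤⟨ *≤* (ℤ.+≤+ (s≤s (ℕ.≤-trans (ℕ.m≤n+m (suc (k ℕ.+ 0)) k) (ℕ.m≤m+n _ 0)))) ⟩
  mkℚᵘ (ℤ.+ 1) (suc k)           ∎
  where open ℚᵘ.≤-Reasoning

2⁻-archimedean : ∀ {ε} → 0ℚ < ε → ∃[ k ] 2⁻ k < ε
2⁻-archimedean {ε} 0<ε = archimedean ε (ℚ.positive 0<ε)
  where
  archimedean : ∀ ε → Positive ε → ∃[ k ] 2⁻ k < ε
  -- Denominators are stored minus one: ε = (n + 1)/(d + 1) > 1/(d + 2), and the latter bounds
  -- `2⁻ suc d`.
  archimedean (mkℚ +[1+ n ] d _) _ = suc d , ℚ.toℚᵘ-cancel-<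
    (ℚᵘ.≤-<-trans (2⁻≤1/suc (suc d))
      (*<* (ℤ.+<+ (ℕ.≤-trans (s≤s (ℕ.≤-reflexive (ℕ.+-identityʳ (suc d)))) (ℕ.m≤m+n (suc (suc d)) _)))))

∑<-nonNeg : ∀ n {a} → (∀ i → 0ℚ ≤ a i) → 0ℚ ≤ ∑< n a
∑<-nonNeg zero    0≤a = ℚ.≤-refl
∑<-nonNeg (suc n) 0≤a = ℚ.+-mono-≤ (0≤a 0) (∑<-nonNeg n (0≤a ∘ suc))

∑<-mono : ∀ {m n a} → (∀ i → 0ℚ ≤ a i) → m ℕ.≤ n → ∑< m a ≤ ∑< n a
∑<-mono {n = n} 0≤a z≤n       = ∑<-nonNeg n 0≤a
∑<-mono {a = a} 0≤a (s≤s m≤n) = ℚ.+-monoʳ-≤ (a 0) (∑<-mono (0≤a ∘ suc) m≤n)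

term≤∑< : ∀ {a} → (∀ i → 0ℚ ≤ a i) → ∀ i → a i ≤ ∑< (suc i) a
term≤∑< {a} 0≤a zero    = ℚ.≤-reflexive (sym (ℚ.+-identityʳ (a 0)))
term≤∑< {a} 0≤a (suc i) = begin
  a (suc i)                      ≤⟨ term≤∑< (0≤a ∘ suc) i ⟩
  ∑< (suc i) (a ∘ suc)           ≡⟨ ℚ.+-identityˡ _ ⟨
  0ℚ + ∑< (suc i) (a ∘ suc)      ≤⟨ ℚ.+-monoˡ-≤ _ (0≤a 0) ⟩
  a 0 + ∑< (suc i) (a ∘ suc)     ∎
  where open ℚ.≤-Reasoning

∑<-cong : ∀ n {a b} → (∀ i → a i ≡ b i) → ∑< n a ≡ ∑< n b
∑<-cong zero    a≗b = refl
∑<-cong (suc n) a≗b = cong₂ _+_ (a≗b 0) (∑<-cong n (a≗b ∘ suc))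

∑<-average : ∀ n a b →
  ∑< n (λ i → ½ * a i + ½ * b i) ≡ ½ * ∑< n a + ½ * ∑< n b
∑<-average zero    a b = refl
∑<-average (suc n) a b = trans
  (cong ((½ * a 0 + ½ * b 0) +_) (∑<-average n (a ∘ suc) (b ∘ suc)))
  (solve 5 (λ h a b s t → (h :* a :+ h :* b) :+ (h :* s :+ h :* t) := h :* (a :+ s) :+ h :* (b :+ t))
    refl ½ (a 0) (b 0) (∑< n (a ∘ suc)) (∑< n (b ∘ suc)))
  where open +-*-Solver

∑<-geometric : ∀ n L {a} → (∀ i → a i ≡ 2⁻ (suc L ℕ.+ i)) → ∑< n a ≤ 2⁻ L
∑<-geometric zero    L     a≗ = ℚ.<⇒≤ (0<2⁻ L)
∑<-geometric (suc n) L {a} a≗ = begin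
  a 0 + ∑< n (a ∘ suc)        ≡⟨ cong (_+ _) (trans (a≗ 0) (cong 2⁻_ (ℕ.+-identityʳ (suc L)))) ⟩
  2⁻ suc L + ∑< n (a ∘ suc)   ≤⟨ ℚ.+-monoʳ-≤ (2⁻ suc L) (∑<-geometric n (suc L)
                                   (λ i → trans (a≗ (suc i)) (cong 2⁻_ (ℕ.+-suc (suc L) i)))) ⟩
  2⁻ suc L + 2⁻ suc L         ≡⟨ ½p+½p≡p (2⁻ L) ⟩
  2⁻ L                        ∎
  where open ℚ.≤-Reasoning

-- The relative measure μ(N_s ∩ N_u) / μ(N_u).
ν : List Bool → List Bool → ℚ
ν []          s           = 2⁻ length s
ν (_ ∷ _)     []          = 1ℚ
ν (true ∷ u)  (true ∷ s)  = ν u s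
ν (true ∷ u)  (false ∷ s) = 0ℚ
ν (false ∷ u) (true ∷ s)  = 0ℚ
ν (false ∷ u) (false ∷ s) = ν u s

ν-nonNeg : ∀ u s → 0ℚ ≤ ν u s
ν-nonNeg []          s           = ℚ.<⇒≤ (0<2⁻ (length s))
ν-nonNeg (_ ∷ _)     []          = ℚ.nonNegative⁻¹ 1ℚ
ν-nonNeg (true ∷ u)  (true ∷ s)  = ν-nonNeg u s
ν-nonNeg (true ∷ u)  (false ∷ s) = ℚ.≤-refl
ν-nonNeg (false ∷ u) (true ∷ s)  = ℚ.≤-refl
ν-nonNeg (false ∷ u) (false ∷ s) = ν-nonNeg u s

2⁻≤1 : ∀ n → 2⁻ n ≤ 1ℚ
2⁻≤1 n = 2⁻-antitone {n = n} z≤n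

ν≤1 : ∀ u s → ν u s ≤ 1ℚ
ν≤1 []          s           = 2⁻≤1 (length s)
ν≤1 (_ ∷ _)     []          = ℚ.≤-refl
ν≤1 (true ∷ u)  (true ∷ s)  = ν≤1 u s
ν≤1 (true ∷ u)  (false ∷ s) = ℚ.nonNegative⁻¹ 1ℚ
ν≤1 (false ∷ u) (true ∷ s)  = ℚ.nonNegative⁻¹ 1ℚ
ν≤1 (false ∷ u) (false ∷ s) = ν≤1 u s

-- N_u splits into two halves of equal measure; so `ν` is a martingale in its first argument.
ν-average : ∀ u s → ν u s ≡ ½ * ν (u ∷ʳ true) s + ½ * ν (u ∷ʳ false) s
ν-average []          []          = refl
ν-average []          (true ∷ s)  = sym (ℚ.+-identityʳ _)
ν-average []          (false ∷ s) = sym (ℚ.+-identityˡ _)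
ν-average (_ ∷ _)     []          = refl
ν-average (true ∷ u)  (true ∷ s)  = ν-average u s
ν-average (true ∷ u)  (false ∷ s) = refl
ν-average (false ∷ u) (true ∷ s)  = refl
ν-average (false ∷ u) (false ∷ s) = ν-average u s

ν-refl : ∀ s → ν s s ≡ 1ℚ
ν-refl []          = refl
ν-refl (true ∷ s)  = ν-refl s
ν-refl (false ∷ s) = ν-refl s

ν-disjoint : ∀ {u s} → length u ≡ length s → u ≢ s → ν u s ≡ 0ℚ
ν-disjoint {[]}        {[]}        _ u≢s = contradiction refl u≢s
ν-disjoint {true ∷ u}  {true ∷ s}  l u≢s = ν-disjoint (ℕ.suc-injective l) (u≢s ∘ cong (true ∷_))
ν-disjoint {true ∷ u}  {false ∷ s} _ _   = refl
ν-disjoint {false ∷ u} {true ∷ s}  _ _   = refl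
ν-disjoint {false ∷ u} {false ∷ s} l u≢s = ν-disjoint (ℕ.suc-injective l) (u≢s ∘ cong (false ∷_))

-- Covers and density

Covers : (ℕ → List Bool) → ℚ → Subset → Set
Covers s r S = S ⊆ ⋃ ℕ (λ i → N (s i)) × (∀ n → ∑< n (λ i → 2⁻ length (s i)) ≤ r)

-- The i-th word has length L + 1 + i, so that any sequence of points yields a
-- cover of total weight at most 2^{-L}, of which usually only a few terms matter.
slivers : (ℕ → 2^ω) → ℕ → ℕ → List Bool
slivers v L i = v i ↾ (suc L ℕ.+ i)

slivers-sum : ∀ v L n → ∑< n (λ i → 2⁻ length (slivers v L i)) ≤ 2⁻ L
slivers-sum v L n = ∑<-geometric n L (λ i → cong 2⁻_ (length-applyUpTo (v i) (suc L ℕ.+ i)))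

-- A form of density 0 that keeps the covers explicit.
NegligibleAt : Subset → 2^ω → Set
NegligibleAt D x = ∀ k → ∃[ m ] ∀ n → m ℕ.≤ n →
  ∃[ L ] k ℕ.+ n ℕ.≤ L × ∃[ v ] D ∩ N (x ↾ n) ⊆ ⋃ ℕ (λ i → N (slivers v L i))

2⁻k<ε⇒2⁻L<ε*2⁻n : ∀ k n {L ε} → 2⁻ k < ε → k ℕ.+ n ℕ.≤ L → 2⁻ L < ε * 2⁻ n
2⁻k<ε⇒2⁻L<ε*2⁻n k n {L} {ε} 2⁻k<ε k+n≤L = begin-strict
  2⁻ L           ≤⟨ 2⁻-antitone k+n≤L ⟩
  2⁻ (k ℕ.+ n)   ≡⟨ 2⁻-+ k n ⟩
  2⁻ k * 2⁻ n    <⟨ ℚ.*-monoˡ-<-pos (2⁻ n) ⦃ 2⁻-positive n ⦄ 2⁻k<ε ⟩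
  ε * 2⁻ n       ∎
  where open ℚ.≤-Reasoning

negligible⇒density-0 : ∀ {D x} → NegligibleAt D x → HasDensity D x 0ℚ
negligible⇒density-0 {D} {x} neg ε 0<ε with k , 2⁻k<ε ← 2⁻-archimedean 0<ε
  with m , cover ← neg k = m , λ n m≤n → lower n , upper n m≤n
  where
  lower : ∀ n → 0ℚ - ε <ʳ localMeasure D x n
  lower n = 0ℚ , ℚ.+-monoʳ-< 0ℚ (ℚ.neg-antimono-< 0<ε) ,
    -- The empty partial sum already rules out a bound r < 0.
    λ (_ , _ , r , r<0 , ≤r) → ℚ.<-irrefl refl
      (ℚ.≤-<-trans (≤r 0) (ℚ.<-≤-trans r<0 (ℚ.≤-reflexive (ℚ.*-zeroˡ (2⁻ n)))))

  upper : ∀ n → m ℕ.≤ n → localMeasure D x n ʳ< 0ℚ + ε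
  upper n m≤n with L , k+n≤L , v , ⊆slivers ← cover n m≤n =
    slivers v L , ⊆slivers , 2⁻ L ,
    2⁻k<ε⇒2⁻L<ε*2⁻n k n (ℚ.<-≤-trans 2⁻k<ε (ℚ.≤-reflexive (sym (ℚ.+-identityˡ ε)))) k+n≤L ,
    slivers-sum v L

negligible-antitone : ∀ {D D′ x} → D′ ⊆ D → NegligibleAt D x → NegligibleAt D′ x
negligible-antitone D′⊆D neg k with m , cover ← neg k = m , λ n m≤n →
  let L , k+n≤L , v , ⊆slivers = cover n m≤n in L , k+n≤L , v , ⊆slivers ∘ map₁ D′⊆D

-- With ε = ½, both limits compare the same ratio with ½ at a common stage, with opposite outcomes.
density-0∧1⇒⊥ : ∀ {S x} → HasDensity S x 0ℚ → ¬ HasDensity S x 1ℚ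
density-0∧1⇒⊥ d₀ d₁ with m₀ , e₀ ← d₀ ½ (ℚ.positive⁻¹ ½) | m₁ , e₁ ← d₁ ½ (ℚ.positive⁻¹ ½) =
  let n = m₀ ℕ.⊔ m₁
      s , S⊆ , r , r< , ≤r = proj₂ (e₀ n (ℕ.m≤m⊔n m₀ m₁))
      q , ½<q , q∉ = proj₁ (e₁ n (ℕ.m≤n⊔m m₀ m₁))
  in q∉ (s , S⊆ , r , ℚ.<-trans r< (ℚ.*-monoˡ-<-pos (2⁻ n) ⦃ 2⁻-positive n ⦄ ½<q) , ≤r)

-- Topology of 2^ω

AgreeBelow : ℕ → 2^ω → 2^ω → Set
AgreeBelow n x y = ∀ {i} → i ℕ.< n → x i ≡ y i

↾-cong : ∀ n {x y} → AgreeBelow n x y → x ↾ n ≡ y ↾ n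
↾-cong zero    x≈y = refl
↾-cong (suc n) x≈y = cong₂ _∷_ (x≈y (s≤s z≤n)) (↾-cong n (x≈y ∘ s≤s))

↾-injective : ∀ n {x y} → x ↾ n ≡ y ↾ n → AgreeBelow n x y
↾-injective (suc n) eq {zero}  _         = proj₁ (∷-injective eq)
↾-injective (suc n) eq {suc i} (s≤s i<n) = ↾-injective n (proj₂ (∷-injective eq)) i<n

agree⇒∈N : ∀ n {x y} → AgreeBelow n y x → y ∈ N (x ↾ n)
agree⇒∈N n {x} {y} y≈x = trans (cong (y ↾_) (length-applyUpTo x n)) (↾-cong n y≈x)

∈N⇒agree : ∀ n {x y} → y ∈ N (x ↾ n) → AgreeBelow n y x
∈N⇒agree n {x} {y} y∈N = ↾-injective n (trans (cong (y ↾_) (sym (length-applyUpTo x n))) y∈N)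

open-resp-≗ : ∀ {U x y} → Open U → (∀ i → x i ≡ y i) → x ∈ U → y ∈ U
open-resp-≗ openU x≗y x∈U with n , N⊆U ← openU x∈U = N⊆U (agree⇒∈N n λ {i} _ → sym (x≗y i))

-- Inherited from the open sets of the Gδ form. It stands in for extensionality where
-- `decode (code x)` is only pointwise equal to x.
Δ⁰₂-resp-≗ : ∀ {A} → Δ⁰₂ A → ∀ {x y} → (∀ i → x i ≡ y i) → x ∈ A → y ∈ A
Δ⁰₂-resp-≗ (_ , _ , openG , A⊆G , G⊆A) x≗y x∈A =
  G⊆A λ n → open-resp-≗ (openG n) x≗y (A⊆G x∈A n)

modulus⇒continuous : ∀ {f} →
  (∀ x n → ∃[ k ] ∀ {y} → AgreeBelow k y x → AgreeBelow n (f y) (f x)) → Continuous f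
modulus⇒continuous modulus openU {x} fx∈U with n , N⊆U ← openU fx∈U
  with k , near ← modulus x n = k , λ y∈N → N⊆U (agree⇒∈N n (near (∈N⇒agree k y∈N)))

extend : List Bool → 2^ω
extend []      i       = false
extend (b ∷ s) zero    = b
extend (b ∷ s) (suc i) = extend s i

extend∈N : ∀ s → extend s ∈ N s
extend∈N []      = refl
extend∈N (b ∷ s) = cong (b ∷_) (extend∈N s)

-- Interleaving two sequences

interleave : {A : Set₁} → (ℕ → A) → (ℕ → A) → ℕ → A
interleave a b zero    = a zero
interleave a b (suc n) = interleave b (a ∘ suc) n

interleave⁺ : ∀ {ℓ} {A : Set₁} (P : Pred A ℓ) {a b : ℕ → A} →
  (∀ n → P (a n)) → (∀ n → P (b n)) → ∀ n → P (interleave a b n)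
interleave⁺ P Pa Pb zero    = Pa zero
interleave⁺ P Pa Pb (suc n) = interleave⁺ P Pb (Pa ∘ suc) n

mutual
  interleave-left : ∀ {ℓ} {A : Set₁} (P : Pred A ℓ) {a b : ℕ → A} n →
    P (a n) → ∃[ i ] P (interleave a b i)
  interleave-left P zero    p = zero , p
  interleave-left P (suc n) p = map suc id (interleave-right P n p)

  interleave-right : ∀ {ℓ} {A : Set₁} (P : Pred A ℓ) {a b : ℕ → A} n →
    P (b n) → ∃[ i ] P (interleave a b i)
  interleave-right P n p = map suc id (interleave-left P n p)

-- Blocks, coding positions and padding

-- The coding position of block m; the block ends just before p (suc m).
p : ℕ → ℕ
p zero    = zero
p (suc m) = suc m ℕ.+ p m

p<p∘suc : ∀ m → p m ℕ.< p (suc m)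
p<p∘suc m = s≤s (ℕ.m≤n+m (p m) m)

p-mono-≤ : ∀ {m n} → m ℕ.≤ n → p m ℕ.≤ p n
p-mono-≤ {n = n} z≤n       = z≤n
p-mono-≤         (s≤s m≤n) = ℕ.+-mono-≤ (s≤s m≤n) (p-mono-≤ m≤n)

p-mono-< : ∀ {m n} → m ℕ.< n → p m ℕ.< p n
p-mono-< {m} m<n = ℕ.<-≤-trans (p<p∘suc m) (p-mono-≤ m<n)

p-injective : ∀ {m n} → p m ≡ p n → m ≡ n
p-injective {m} {n} eq with ℕ.<-cmp m n
... | tri< m<n _ _ = contradiction eq (ℕ.<⇒≢ (p-mono-< m<n))
... | tri≈ _ m≡n _ = m≡n
... | tri> _ _ n<m = contradiction (sym eq) (ℕ.<⇒≢ (p-mono-< n<m))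

m≤p : ∀ m → m ℕ.≤ p m
m≤p zero    = z≤n
m≤p (suc m) = ℕ.m≤m+n (suc m) (p m)

between≢p : ∀ m {j} → p m ℕ.< j → j ℕ.< p (suc m) → ∀ k → p k ≢ j
between≢p m pm<j j<p k refl with k ℕ.≤? m
... | yes k≤m = ℕ.<-irrefl refl (ℕ.<-≤-trans pm<j (p-mono-≤ k≤m))
... | no  k≰m = ℕ.<-irrefl refl (ℕ.<-≤-trans j<p (p-mono-≤ (ℕ.≰⇒> k≰m)))

-- The bracket is half-open because a restriction to n then settles the coding position `p m` and
-- leaves `p (suc m)` free.
p-bracket : ∀ l n → p l ℕ.< n → ∃[ m ] l ℕ.≤ m × p m ℕ.< n × n ℕ.≤ p (suc m)
p-bracket l (suc n) pl<1+n with ℕ.m<1+n⇒m<n∨m≡n pl<1+n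
... | inj₂ refl = l , ℕ.≤-refl , pl<1+n , p<p∘suc l
... | inj₁ pl<n with m , l≤m , pm<n , n≤p ← p-bracket l n pl<n with ℕ.m≤n⇒m<n∨m≡n n≤p
...   | inj₁ n<p = m , l≤m , ℕ.m<n⇒m<1+n pm<n , n<p
...   | inj₂ refl = suc m , ℕ.m≤n⇒m≤1+n l≤m , ℕ.n<1+n (p (suc m)) , p<p∘suc (suc m)

-- What is left is the closed set of sequences with zero padding, which is the range of `code` up to
-- pointwise equality.
Leaves : 2^ω → ℕ → Set
Leaves y m = ∃[ j ] p m ℕ.< j × j ℕ.< p (suc m) × y j ≡ true

Exits : 2^ω → ℕ → Set
Exits y m = Leaves y m × (∀ {k} → k ℕ.< m → ¬ Leaves y k)

leaves-local : ∀ {n} m {y y′} → AgreeBelow n y y′ → p (suc m) ℕ.≤ n → Leaves y m → Leaves y′ m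
leaves-local m y≈y′ p≤n (j , p<j , j<p , yj) = j , p<j , j<p , trans (sym (y≈y′ (ℕ.<-≤-trans j<p p≤n))) yj

exits-local : ∀ {n} m {y y′} → AgreeBelow n y y′ → p (suc m) ℕ.≤ n → Exits y m → Exits y′ m
exits-local m y≈y′ p≤n (leaves , first) = leaves-local m y≈y′ p≤n leaves ,
  λ {k} k<m → first k<m ∘ leaves-local k (sym ∘ y≈y′) (ℕ.≤-trans (p-mono-≤ (s≤s (ℕ.<⇒≤ k<m))) p≤n)

exits-unique : ∀ {y m n} → Exits y m → Exits y n → m ≡ n
exits-unique {m = m} {n} (l , first) (l′ , first′) with ℕ.<-cmp m n
... | tri< m<n _ _ = contradiction l (first′ m<n)
... | tri≈ _ m≡n _ = m≡n
... | tri> _ _ n<m = contradiction l′ (first n<m)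

¬leaves⇒false : ∀ m {y j} → ¬ Leaves y m → p m ℕ.< j → j ℕ.< p (suc m) → y j ≡ false
¬leaves⇒false m ¬leaves p<j j<p = ¬-not λ yj → ¬leaves (_ , p<j , j<p , yj)

decode : 2^ω → 2^ω
decode y = y ∘ p

decode-local : ∀ {n} m {y y′} → AgreeBelow n y y′ → p m ℕ.≤ n → AgreeBelow m (decode y) (decode y′)
decode-local m y≈y′ p≤n i<m = y≈y′ (ℕ.<-≤-trans (p-mono-< i<m) p≤n)

update : 2^ω → ℕ → Bool → 2^ω
update y a b i with i ℕ.≟ a
... | yes _ = b
... | no  _ = y i

agree-update : ∀ {l a b y y′} → (∀ {i} → i ℕ.< l → i ≢ a → y′ i ≡ y i) → y′ a ≡ b →
  AgreeBelow l y′ (update y a b)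
agree-update {a = a} off at {i} i<l with i ℕ.≟ a
... | yes refl = at
... | no  i≢a  = off i<l i≢a

Tracks : (List Bool → 2^ω) → Subset → Set
Tracks z Q = ∀ {x} → x ∈ Q → ∃[ l ] ∀ {m} → l ℕ.≤ m → z (x ↾ m) ∈ Q

-- Classical logic and lower bounds for covers

module Classical (em : ExcludedMiddle 0ℓ) where

  byContradiction : {P : Set} → ¬ ¬ P → P
  byContradiction = decidable-stable em

  ¬∀⇒∃¬ : {I : Set} {P : I → Set} → ¬ (∀ i → P i) → ∃[ i ] ¬ P i
  ¬∀⇒∃¬ ¬∀ = byContradiction λ ¬∃ → ¬∀ λ i → byContradiction λ ¬p → ¬∃ (i , ¬p)

  -- If r bounds the weights of a node then it bounds those of one of its
  -- children, and so of all nodes along some branch.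
  supermartingale-bound : (W : List Bool → ℕ → ℚ) →
    (∀ u {m n} → m ℕ.≤ n → W u m ≤ W u n) →
    (∀ u n → ½ * W (u ∷ʳ true) n + ½ * W (u ∷ʳ false) n ≤ W u n) →
    (∀ x → ∃[ k ] ∃[ n ] 1ℚ ≤ W (x ↾ k) n) →
    ∀ {r} → (∀ n → W [] n ≤ r) → 1ℚ ≤ r
  supermartingale-bound W mono fair hit {r} root =
    let k , n , 1≤W = hit branch in ℚ.≤-trans 1≤W (bounded k n)
    where
    Bounded : List Bool → Set
    Bounded u = ∀ n → W u n ≤ r

    next : List Bool → Bool
    next u with em {Bounded (u ∷ʳ true)}
    ... | yes _ = true
    ... | no  _ = false

    node : ℕ → List Bool
    node zero    = []
    node (suc k) = node k ∷ʳ next (node k)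

    branch : 2^ω
    branch = next ∘ node

    branch↾ : ∀ k → branch ↾ k ≡ node k
    branch↾ zero    = refl
    branch↾ (suc k) = trans (sym (applyUpTo-∷ʳ branch k)) (cong (_∷ʳ branch k) (branch↾ k))

    next-bounded : ∀ u → Bounded u → Bounded (u ∷ʳ next u)
    next-bounded u b with em {Bounded (u ∷ʳ true)}
    ... | yes b₁ = b₁
    -- If the `false` child exceeded r at n and the `true` child at m, then by `mono` both would at
    -- `m ⊔ n`, and so would their mean, which the parent bounds.
    ... | no ¬b₁ = λ n → ℚ.≮⇒≥ λ r<W₀ →
      let m , W₁≰r = ¬∀⇒∃¬ ¬b₁
          l = m ℕ.⊔ n
      in ℚ.<-irrefl refl (begin-strict
        r                                              ≡⟨ ½p+½p≡p r ⟨
        ½ * r + ½ * r                                  <⟨ ℚ.+-mono-<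
          (ℚ.*-monoʳ-<-pos ½ (ℚ.<-≤-trans (ℚ.≰⇒> W₁≰r) (mono (u ∷ʳ true) (ℕ.m≤m⊔n m n))))
          (ℚ.*-monoʳ-<-pos ½ (ℚ.<-≤-trans r<W₀ (mono (u ∷ʳ false) (ℕ.m≤n⊔m m n)))) ⟩
        ½ * W (u ∷ʳ true) l + ½ * W (u ∷ʳ false) l      ≤⟨ fair u l ⟩
        W u l                                          ≤⟨ b l ⟩
        r                                              ∎)
      where open ℚ.≤-Reasoning

    node-bounded : ∀ k → Bounded (node k)
    node-bounded zero    = root
    node-bounded (suc k) = next-bounded (node k) (node-bounded k)

    bounded : ∀ k → Bounded (branch ↾ k)
    bounded k = subst Bounded (sym (branch↾ k)) (node-bounded k)

  -- Together the two covers cover N_t, so they cannot weigh less than it does. This turns a light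
  -- cover of the rest of N_t into a lower bound for every cover of S ∩ N_t.
  covers-N : ∀ {S t s s′ r r′} →
    Covers s r (S ∩ N t) → Covers s′ r′ (∁ S ∩ N t) → 2⁻ length t ≤ r + r′
  covers-N {S} {t} {s} {s′} {r} {r′} (S⊆ , ≤r) (∁S⊆ , ≤r′) = begin
    -- At the root `ν [] t` is `2⁻ length t`, so `out []` is 1 minus this.
    2⁻ length t                                ≡⟨ solve 1 (λ p → p := con 1ℚ :+ (p :- con 1ℚ)) refl (2⁻ length t) ⟩
    1ℚ + (2⁻ length t - 1ℚ)                    ≤⟨ ℚ.+-monoˡ-≤ _ 1≤r+r′+out ⟩
    r + r′ + out [] + (2⁻ length t - 1ℚ)       ≡⟨ solve 3 (λ r r′ p → r :+ r′ :+ (con 1ℚ :- p) :+ (p :- con 1ℚ) := r :+ r′) refl r r′ (2⁻ length t) ⟩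
    r + r′                                     ∎
    where
    open ℚ.≤-Reasoning
    open +-*-Solver

    total : (ℕ → List Bool) → List Bool → ℕ → ℚ
    total s u n = ∑< n (λ i → ν u (s i))

    total-nonNeg : ∀ s u n → 0ℚ ≤ total s u n
    total-nonNeg s u n = ∑<-nonNeg n (ν-nonNeg u ∘ s)

    total-average : ∀ s u n → total s u n ≡ ½ * total s (u ∷ʳ true) n + ½ * total s (u ∷ʳ false) n
    total-average s u n = trans (∑<-cong n (ν-average u ∘ s)) (∑<-average n _ _)

    1≤total : ∀ s {x} → x ∈ ⋃ ℕ (λ i → N (s i)) → ∃[ k ] ∃[ n ] 1ℚ ≤ total s (x ↾ k) n
    1≤total s {x} (i , x∈) = length (s i) , suc i , (begin
      1ℚ                             ≡⟨ ν-refl (s i) ⟨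
      ν (s i) (s i)                  ≡⟨ cong (λ u → ν u (s i)) x∈ ⟨
      ν (x ↾ length (s i)) (s i)     ≤⟨ term≤∑< (ν-nonNeg (x ↾ length (s i)) ∘ s) i ⟩
      total s (x ↾ length (s i)) (suc i) ∎)

    -- The relative measure of ∁ N_t: adding it to the weights of the two covers
    -- of the parts of N_t gives a supermartingale that reaches 1 on every branch.
    out : List Bool → ℚ
    out u = 1ℚ - ν u t

    out-nonNeg : ∀ u → 0ℚ ≤ out u
    out-nonNeg u = ℚ.+-monoʳ-≤ 1ℚ (ℚ.neg-antimono-≤ (ν≤1 u t))

    W : List Bool → ℕ → ℚ
    W u n = total s u n + total s′ u n + out u

    W-mono : ∀ u {m n} → m ℕ.≤ n → W u m ≤ W u n
    W-mono u m≤n = ℚ.+-monoˡ-≤ (out u)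
      (ℚ.+-mono-≤ (∑<-mono (ν-nonNeg u ∘ s) m≤n) (∑<-mono (ν-nonNeg u ∘ s′) m≤n))

    W-fair : ∀ u n → ½ * W (u ∷ʳ true) n + ½ * W (u ∷ʳ false) n ≤ W u n
    W-fair u n = ℚ.≤-reflexive (trans
      (solve 6 (λ a b c a′ b′ c′ →
          con ½ :* (a :+ b :+ (con 1ℚ :- c)) :+ con ½ :* (a′ :+ b′ :+ (con 1ℚ :- c′))
          := (con ½ :* a :+ con ½ :* a′) :+ (con ½ :* b :+ con ½ :* b′)
             :+ (con 1ℚ :- (con ½ :* c :+ con ½ :* c′)))
        refl
        (total s (u ∷ʳ true) n) (total s′ (u ∷ʳ true) n) (ν (u ∷ʳ true) t)
        (total s (u ∷ʳ false) n) (total s′ (u ∷ʳ false) n) (ν (u ∷ʳ false) t))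
      (sym (cong₂ _+_ (cong₂ _+_ (total-average s u n) (total-average s′ u n))
        (cong (1ℚ -_) (ν-average u t)))))

    W-hit : ∀ x → ∃[ k ] ∃[ n ] 1ℚ ≤ W (x ↾ k) n
    W-hit x with em {x ∈ N t} | em {x ∈ S}
    -- Off N_t, `out` alone reaches 1 at the level of t, so empty sums suffice.
    ... | no x∉N | _ = length t , 0 ,
      ℚ.≤-reflexive (sym (cong (λ p → 0ℚ + 0ℚ + (1ℚ - p)) (ν-disjoint (length-applyUpTo x (length t)) x∉N)))
    ... | yes x∈N | yes x∈S with k , n , 1≤ ← 1≤total s (S⊆ (x∈S , x∈N)) = k , n ,
      ℚ.+-mono-≤ (ℚ.+-mono-≤ 1≤ (total-nonNeg s′ (x ↾ k) n)) (out-nonNeg (x ↾ k))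
    ... | yes x∈N | no x∉S with k , n , 1≤ ← 1≤total s′ (∁S⊆ (x∉S , x∈N)) = k , n ,
      ℚ.+-mono-≤ (ℚ.+-mono-≤ (total-nonNeg s (x ↾ k) n) 1≤) (out-nonNeg (x ↾ k))

    1≤r+r′+out : 1ℚ ≤ r + r′ + out []
    1≤r+r′+out = supermartingale-bound W W-mono W-fair W-hit
      λ n → ℚ.+-monoˡ-≤ (out []) (ℚ.+-mono-≤ (≤r n) (≤r′ n))

  -- The slivers around ∁ S weigh at most `2⁻ k * 2⁻ n`, so by `covers-N` every cover of S ∩ N_(x↾n)
  -- weighs at least `(1ℚ - 2⁻ k) * 2⁻ n`.
  negligible⇒density-1 : ∀ {S x} → NegligibleAt (∁ S) x → HasDensity S x 1ℚ
  negligible⇒density-1 {S} {x} neg ε 0<ε with k , 2⁻k<ε ← 2⁻-archimedean 0<ε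
    with m , cover ← neg k = m , λ n m≤n → lower n m≤n , upper n
    where
    open ℚ.≤-Reasoning
    open +-*-Solver

    lower : ∀ n → m ℕ.≤ n → 1ℚ - ε <ʳ localMeasure S x n
    lower n m≤n with L , k+n≤L , v , ⊆slivers ← cover n m≤n =
      1ℚ - 2⁻ k , ℚ.+-monoʳ-< 1ℚ (ℚ.neg-antimono-< 2⁻k<ε) ,
      λ (s , S⊆ , r , r< , ≤r) → ℚ.<-irrefl refl (begin-strict
        2⁻ n                                    ≡⟨ cong 2⁻_ (length-applyUpTo x n) ⟨
        2⁻ length (x ↾ n)                       ≤⟨ covers-N {S} (S⊆ , ≤r) (⊆slivers , slivers-sum v L) ⟩
        r + 2⁻ L                                <⟨ ℚ.+-mono-<-≤ r< (ℚ.≤-trans (2⁻-antitone k+n≤L) (ℚ.≤-reflexive (2⁻-+ k n))) ⟩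
        (1ℚ - 2⁻ k) * 2⁻ n + 2⁻ k * 2⁻ n
          ≡⟨ solve 2 (λ a b → (con 1ℚ :- a) :* b :+ a :* b := b) refl (2⁻ k) (2⁻ n) ⟩
        2⁻ n                                    ∎)

    upper : ∀ n → localMeasure S x n ʳ< 1ℚ + ε
    -- A cover is an infinite sequence of words of positive weight, so `x ↾ n` is followed by
    -- slivers that stay within the slack `ε * 2⁻ n`.
    upper n = s , (λ x∈ → 0 , proj₂ x∈) , 2⁻ n + 2⁻ (k ℕ.+ n) , r< , ≤r
      where
      s : ℕ → List Bool
      s zero    = x ↾ n
      s (suc i) = slivers (const x) (k ℕ.+ n) i

      r< : 2⁻ n + 2⁻ (k ℕ.+ n) < (1ℚ + ε) * 2⁻ n
      r< = begin-strict
        2⁻ n + 2⁻ (k ℕ.+ n)       <⟨ ℚ.+-monoʳ-< (2⁻ n) (2⁻k<ε⇒2⁻L<ε*2⁻n k n 2⁻k<ε ℕ.≤-refl) ⟩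
        2⁻ n + ε * 2⁻ n           ≡⟨ solve 2 (λ a b → b :+ a :* b := (con 1ℚ :+ a) :* b) refl ε (2⁻ n) ⟩
        (1ℚ + ε) * 2⁻ n           ∎

      ≤r : ∀ j → ∑< j (λ i → 2⁻ length (s i)) ≤ 2⁻ n + 2⁻ (k ℕ.+ n)
      ≤r zero    = ℚ.<⇒≤ (ℚ.+-mono-< (0<2⁻ n) (0<2⁻ (k ℕ.+ n)))
      ≤r (suc j) = ℚ.+-mono-≤ (ℚ.≤-reflexive (cong 2⁻_ (length-applyUpTo x n)))
        (slivers-sum (const x) (k ℕ.+ n) j)

  -- Approximation of Δ⁰₂ sets by points

  least : {P : ℕ → Set} → (∃[ n ] P n) → ∃[ m ] P m × (∀ {k} → k ℕ.< m → ¬ P k)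
  least {P} (n , pn) with search (suc n)
    where
    search : ∀ n → (∀ {k} → k ℕ.< n → ¬ P k) ⊎ (∃[ m ] P m × (∀ {k} → k ℕ.< m → ¬ P k))
    search zero = inj₁ λ ()
    search (suc n) with search n
    ... | inj₂ found = inj₂ found
    ... | inj₁ none with em {P n}
    ...   | yes pn = inj₂ (n , pn , none)
    ...   | no ¬pn = inj₁ λ k<1+n pk → case-≤ (ℕ.m<1+n⇒m<n∨m≡n k<1+n) pk
      where
      case-≤ : ∀ {k} → k ℕ.< n ⊎ k ≡ n → ¬ P k
      case-≤ (inj₁ k<n)  = none k<n
      case-≤ (inj₂ refl) = ¬pn
  ... | inj₁ none  = contradiction pn (none ℕ.≤-refl)
  ... | inj₂ found = found

  eventually-all : ∀ {Q : ℕ → ℕ → Set} j →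
    (∀ {i} → i ℕ.< j → ∃[ l ] ∀ {m} → l ℕ.≤ m → Q i m) →
    ∃[ l ] ∀ {m} → l ℕ.≤ m → ∀ {i} → i ℕ.< j → Q i m
  eventually-all zero    each = 0 , λ _ ()
  eventually-all {Q} (suc j) each
    with l , all ← eventually-all {Q} j (each ∘ ℕ.m<n⇒m<1+n) | l′ , last ← each (ℕ.n<1+n j) =
    l ℕ.⊔ l′ , λ l⊔l′≤m i<1+j → split l⊔l′≤m (ℕ.m<1+n⇒m<n∨m≡n i<1+j)
    where
    split : ∀ {m} → l ℕ.⊔ l′ ℕ.≤ m → ∀ {i} → i ℕ.< j ⊎ i ≡ j → Q i m
    split l≤m (inj₁ i<j)  = all (ℕ.m⊔n≤o⇒m≤o l l′ l≤m) i<j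
    split l≤m (inj₂ refl) = last (ℕ.m⊔n≤o⇒n≤o l l′ l≤m)

  -- Let j be least with x ∈ E_j. The finitely many earlier sets are closed and miss x, hence miss
  -- N_(x↾m) for large m, while E_j always meets it in x. So the index chosen at `x ↾ m` is
  -- eventually j.
  closed-cover-approximation : (E : ℕ → Subset) → (∀ i → Closed (E i)) → (∀ x → ∃[ i ] x ∈ E i) →
    Σ[ z ∈ (List Bool → 2^ω) ] (∀ s → z s ∈ N s) ×
      (∀ x → ∃[ j ] x ∈ E j × (∃[ l ] ∀ {m} → l ℕ.≤ m → z (x ↾ m) ∈ E j))
  closed-cover-approximation E closed cover = z , z∈N , stable
    where
    Meets : List Bool → ℕ → Set
    Meets s i = ∃[ w ] w ∈ N s × w ∈ E i

    first : ∀ s → ∃[ i ] Meets s i × (∀ {k} → k ℕ.< i → ¬ Meets s k)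
    first s = least (map₂ (λ ∈E → extend s , extend∈N s , ∈E) (cover (extend s)))

    index : List Bool → ℕ
    index s = proj₁ (first s)

    z : List Bool → 2^ω
    z s = proj₁ (proj₁ (proj₂ (first s)))

    z∈N : ∀ s → z s ∈ N s
    z∈N s = proj₁ (proj₂ (proj₁ (proj₂ (first s))))

    z∈E : ∀ s → z s ∈ E (index s)
    z∈E s = proj₂ (proj₂ (proj₁ (proj₂ (first s))))

    stable : ∀ x → ∃[ j ] x ∈ E j × (∃[ l ] ∀ {m} → l ℕ.≤ m → z (x ↾ m) ∈ E j)
    stable x with j , x∈Ej , ∉E ← least (cover x)
      with l , avoids ← eventually-all {λ i m → ¬ Meets (x ↾ m) i} j
        (λ {i} i<j → let n , N⊆∁E = closed i (∉E i<j) in n , λ n≤m (w , w∈N , w∈E) →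
          N⊆∁E (agree⇒∈N n λ k<n → ∈N⇒agree _ w∈N (ℕ.<-≤-trans k<n n≤m)) w∈E)
      = j , x∈Ej , l , λ {m} l≤m → subst (λ i → z (x ↾ m) ∈ E i) (index≡j m l≤m) (z∈E (x ↾ m))
      where
      index≡j : ∀ m → l ℕ.≤ m → index (x ↾ m) ≡ j
      index≡j m l≤m = ℕ.≤-antisym
        (ℕ.≮⇒≥ λ j<i → proj₂ (proj₂ (first (x ↾ m))) j<i (x , agree⇒∈N m (λ _ → refl) , x∈Ej))
        (ℕ.≮⇒≥ λ i<j → avoids l≤m i<j (proj₁ (proj₂ (first (x ↾ m)))))

  -- The Fσ form gives closed pieces of A and the Gδ form, by complements, closed pieces of ∁ A;
  -- together they cover. A piece containing x lies on the side of x, in particular the one where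
  -- `z` settles.
  Δ⁰₂-approximation : ∀ {A} → Δ⁰₂ A →
    Σ[ z ∈ (List Bool → 2^ω) ] (∀ s → z s ∈ N s) × Tracks z A × Tracks z (∁ A)
  Δ⁰₂-approximation {A} ((F , closedF , A⊆F , F⊆A) , (G , openG , A⊆G , G⊆A)) =
    z , z∈N , (λ x∈A → tracks {Q = A} (E⊆A-at x∈A)) , λ x∉A → tracks {Q = ∁ A} (E⊆∁A-at x∉A)
    where
    E : ℕ → Subset
    E = interleave F (∁ ∘ G)

    closed : ∀ i → Closed (E i)
    closed = interleave⁺ Closed closedF λ n {x} ¬¬x∈G →
      map₂ (λ N⊆G y∈N y∉G → y∉G (N⊆G y∈N)) (openG n (byContradiction ¬¬x∈G))

    pure : ∀ i → E i ⊆ A ⊎ E i ⊆ ∁ A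
    pure = interleave⁺ (λ S → S ⊆ A ⊎ S ⊆ ∁ A)
      (λ n → inj₁ λ x∈F → F⊆A (n , x∈F)) (λ n → inj₂ λ x∉G x∈A → x∉G (A⊆G x∈A n))

    cover : ∀ x → ∃[ i ] x ∈ E i
    cover x with em {x ∈ A}
    ... | yes x∈A with n , x∈F ← A⊆F x∈A = interleave-left (x ∈_) n x∈F
    ... | no  x∉A with n , x∉G ← ¬∀⇒∃¬ (x∉A ∘ G⊆A) = interleave-right (x ∈_) n x∉G

    approximation = closed-cover-approximation E closed cover
    z = proj₁ approximation
    z∈N = proj₁ (proj₂ approximation)
    stable = proj₂ (proj₂ approximation)

    tracks : ∀ {x} {Q : Subset} → (∀ i → x ∈ E i → E i ⊆ Q) → ∃[ l ] ∀ {m} → l ℕ.≤ m → z (x ↾ m) ∈ Q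
    tracks {x} E⊆Q with j , x∈E , l , z∈E ← stable x = l , λ l≤m → E⊆Q j x∈E (z∈E l≤m)

    E⊆A-at : ∀ {x} → x ∈ A → ∀ i → x ∈ E i → E i ⊆ A
    E⊆A-at x∈A i x∈E with pure i
    ... | inj₁ E⊆A  = E⊆A
    ... | inj₂ E⊆∁A = contradiction x∈A (E⊆∁A x∈E)

    E⊆∁A-at : ∀ {x} → x ∉ A → ∀ i → x ∈ E i → E i ⊆ ∁ A
    E⊆∁A-at x∉A i x∈E with pure i
    ... | inj₁ E⊆A  = contradiction (E⊆A x∈E) x∉A
    ... | inj₂ E⊆∁A = E⊆∁A

  -- The coding map

  code : 2^ω → 2^ω
  code x i with em {∃[ m ] p m ≡ i}
  ... | yes (m , _) = x m
  -- Zero padding by default, so that `g` merely decodes a code.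
  ... | no  _       = false

  code-continuous : Continuous code
  code-continuous = modulus⇒continuous λ x n → n , λ y≈x → local y≈x
    where
    local : ∀ {x y n} → AgreeBelow n y x → AgreeBelow n (code y) (code x)
    local y≈x {i} i<n with em {∃[ m ] p m ≡ i}
    ... | yes (m , refl) = y≈x (ℕ.≤-<-trans (m≤p m) i<n)
    ... | no  _          = refl

  decode-code : ∀ x i → decode (code x) i ≡ x i
  decode-code x i with em {∃[ m ] p m ≡ p i}
  ... | yes (m , pm≡pi) = cong x (p-injective pm≡pi)
  ... | no  ¬p          = contradiction (i , refl) ¬p

  ¬leaves-code : ∀ x m → ¬ Leaves (code x) m
  ¬leaves-code x m (j , p<j , j<p , codej) with em {∃[ k ] p k ≡ j}
  ... | yes (k , pk≡j) = between≢p m p<j j<p k pk≡j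
  ... | no  _ with () ← codej

  -- The map `g` and its continuity

  module Retraction (z : List Bool → 2^ω) (z∈N : ∀ s → z s ∈ N s) where

    g : 2^ω → 2^ω
    g y with em {∃[ m ] Exits y m}
    ... | yes (m , _) = z (decode y ↾ m)
    ... | no  _       = decode y

    g-exits : ∀ {y} m → Exits y m → g y ≡ z (decode y ↾ m)
    g-exits {y} m exits with em {∃[ m ] Exits y m}
    ... | yes (_ , exits′) = cong (λ n → z (decode y ↾ n)) (exits-unique exits′ exits)
    ... | no  stays        = contradiction (_ , exits) stays

    g-stays : ∀ {y} → (∀ m → ¬ Leaves y m) → g y ≡ decode y
    g-stays {y} stays with em {∃[ m ] Exits y m}
    ... | yes (m , leaves , _) = contradiction leaves (stays m)
    ... | no  _                = refl

    -- An exit can only occur in a block m ≥ n, and then the value lies in N_(decode y ↾ m), so it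
    -- agrees with `decode y` below m.
    g-near-decode : ∀ n {y} → (∀ {k} → k ℕ.< n → ¬ Leaves y k) → AgreeBelow n (g y) (decode y)
    g-near-decode n {y} ¬leaves {i} i<n with em {∃[ m ] Exits y m}
    ... | no  _                = refl
    ... | yes (m , leaves , _) = ∈N⇒agree m (z∈N (decode y ↾ m))
      (ℕ.<-≤-trans i<n (ℕ.≮⇒≥ λ m<n → ¬leaves m<n leaves))

    -- The positions below `p (suc m)` determine both the exit block m and the word given to `z`.
    -- The values are therefore equal outright, not only pointwise.
    g-local : ∀ {n} m {y y′} → AgreeBelow n y′ y → p (suc m) ℕ.≤ n → Exits y m → g y′ ≡ g y
    g-local m y′≈y p≤n exits = trans
      (g-exits m (exits-local m (sym ∘ y′≈y) p≤n exits))
      (trans (cong z (↾-cong m (decode-local m y′≈y (ℕ.≤-trans (ℕ.<⇒≤ (p<p∘suc m)) p≤n))))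
        (sym (g-exits m exits)))

    exits-or-stays : ∀ y → (∃[ m ] Exits y m) ⊎ (∀ m → ¬ Leaves y m)
    exits-or-stays y with em {∃[ m ] Leaves y m}
    ... | yes leaves = inj₁ (least leaves)
    ... | no ¬leaves = inj₂ λ m leaves → ¬leaves (m , leaves)

    g-continuous : Continuous g
    g-continuous = modulus⇒continuous modulus
      where
      modulus : ∀ x n → ∃[ k ] ∀ {y} → AgreeBelow k y x → AgreeBelow n (g y) (g x)
      modulus x n with exits-or-stays x
      ... | inj₁ (m , exits) = p (suc m) , λ y≈x {i} _ → cong (λ h → h i) (g-local m y≈x ℕ.≤-refl exits)
      -- Below `p n` lie the first n blocks in full, with their coding positions and padding.
      ... | inj₂ stays = p n , λ y≈x {i} i<n → trans
        (g-near-decode n (λ {k} k<n → stays k ∘ leaves-local k y≈x (p-mono-≤ k<n)) i<n)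
        (trans (decode-local n y≈x ℕ.≤-refl i<n) (sym (g-near-decode n (λ {k} _ → stays k) i<n)))

    -- Points exiting into Q, and how little they miss

    Exited : Subset → Subset
    Exited Q y = (∃[ m ] Exits y m) × g y ∈ Q

    exited-local : ∀ Q {n} m {y y′} → AgreeBelow n y′ y → p (suc m) ℕ.≤ n → Exits y m → g y ∈ Q → y′ ∈ Exited Q
    exited-local Q m y′≈y p≤n exits gy∈Q =
      (m , exits-local m (sym ∘ y′≈y) p≤n exits) , subst Q (sym (g-local m y′≈y p≤n exits)) gy∈Q

    exited-open : ∀ Q → Open (Exited Q)
    exited-open Q {y} ((m , exits) , gy∈Q) =
      p (suc m) , λ {y′} y′∈N → exited-local Q m {y} {y′} (∈N⇒agree (p (suc m)) {y} {y′} y′∈N) ℕ.≤-refl exits gy∈Q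

    -- A point near y that is outside Exited Q cannot leave in block m or m + 1,
    -- since g would then take a value z (decode y ↾ j) ∈ Q there.
    module _ {Q : Subset} {y : 2^ω} (stays : ∀ m → ¬ Leaves y m)
             {l : ℕ} (z∈Q : ∀ {m} → l ℕ.≤ m → z (decode y ↾ m) ∈ Q) where

      ¬leaves-nearby : ∀ {m n y′} → l ℕ.≤ m → p m ℕ.< n → AgreeBelow n y′ y → y′ ∉ Exited Q →
        ∀ {j} → j ℕ.≤ suc m → ¬ Leaves y′ j
      ¬leaves-nearby {m} {n} {y′} l≤m pm<n y′≈y ¬exited {j} j≤1+m leaves
        with j′ , leaves′ , first ← least {Leaves y′} (j , leaves) =
        ¬exited ((j′ , leaves′ , first) , subst Q (sym gy′≡) (z∈Q (ℕ.≤-trans l≤m m≤j′)))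
        where
        j′≤1+m : j′ ℕ.≤ suc m
        j′≤1+m = ℕ.≤-trans (ℕ.≮⇒≥ λ j<j′ → first j<j′ leaves) j≤1+m

        m≤j′ : m ℕ.≤ j′
        -- Blocks before m end by `p m`, where y′ still agrees with y, whose padding is zero.
        m≤j′ = ℕ.≮⇒≥ λ j′<m →
          stays j′ (leaves-local j′ y′≈y (ℕ.≤-trans (p-mono-≤ j′<m) (ℕ.<⇒≤ pm<n)) leaves′)

        gy′≡ : g y′ ≡ z (decode y ↾ j′)
        -- `z` sees only coding positions `p i` with i < j′ ≤ m + 1, which are at most `p m` < n. An
        -- exit in block m + 2 would also involve `p (suc m)`, which need not lie below n.
        gy′≡ = trans (g-exits j′ (leaves′ , first)) (cong z (↾-cong j′ λ i<j′ →
          y′≈y (ℕ.≤-<-trans (p-mono-≤ (ℕ.s≤s⁻¹ (ℕ.<-≤-trans i<j′ j′≤1+m))) pm<n)))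

      -- From n up to `p (suc (suc m))` the only possible coding position is `p (suc m)`; all else
      -- is padding, zero in y and, by `¬leaves-nearby`, in y′.
      agree-off-branching : ∀ {m n y′} → l ℕ.≤ m → p m ℕ.< n → AgreeBelow n y′ y → y′ ∉ Exited Q →
        ∀ {i} → i ℕ.< p (suc (suc m)) → i ≢ p (suc m) → y′ i ≡ y i
      agree-off-branching {m} {n} {y′} l≤m pm<n y′≈y ¬exited {i} i<p i≢p with i ℕ.<? n | ℕ.<-cmp i (p (suc m))
      ... | yes i<n | _            = y′≈y i<n
      ... | no  _   | tri≈ _ i≡p _ = contradiction i≡p i≢p
      ... | no  i≮n | tri< i<p′ _ _ = trans
        (¬leaves⇒false m (¬leaves-nearby l≤m pm<n y′≈y ¬exited (ℕ.n≤1+n m)) pm<i i<p′)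
        (sym (¬leaves⇒false m (stays m) pm<i i<p′))
        where pm<i = ℕ.<-≤-trans pm<n (ℕ.≮⇒≥ i≮n)
      ... | no  _   | tri> _ _ p<i = trans
        (¬leaves⇒false (suc m) (¬leaves-nearby l≤m pm<n y′≈y ¬exited ℕ.≤-refl) p<i i<p)
        (sym (¬leaves⇒false (suc m) (stays (suc m)) p<i i<p))

    -- One point for each value of the free coding bit; the indices from 2 on only fill up the
    -- sequence.
    branches : 2^ω → ℕ → ℕ → 2^ω
    branches y m zero    = update y (p (suc m)) true
    branches y m (suc _) = update y (p (suc m)) false

    -- With L = m + `p (suc m)`, the words 0 and 1 have lengths L + 1 and L + 2 = `p (suc (suc m))`,
    -- just within the range of agreement. If n ≤ `p (suc m)`, the total weight is at most
    -- `2⁻ m * 2⁻ n`.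
    covered-by-branches : ∀ m {y y′} → (∀ {i} → i ℕ.< p (suc (suc m)) → i ≢ p (suc m) → y′ i ≡ y i) →
      y′ ∈ ⋃ ℕ (λ i → N (slivers (branches y m) (m ℕ.+ p (suc m)) i))
    covered-by-branches m {y′ = y′} off with y′ (p (suc m)) in eq
    ... | true  = 0 , agree⇒∈N (suc (m ℕ.+ p (suc m)) ℕ.+ 0)
      (agree-update (λ i<L → off (ℕ.<-trans i<L (s≤s (s≤s (ℕ.≤-reflexive (ℕ.+-identityʳ _)))))) eq)
    ... | false = 1 , agree⇒∈N (suc (m ℕ.+ p (suc m)) ℕ.+ 1)
      (agree-update (λ i<L → off (ℕ.<-≤-trans i<L (s≤s (ℕ.≤-reflexive (ℕ.+-comm _ 1))))) eq)

    ¬exited-negligible : ∀ {Q} → Tracks z Q → ∀ {y} → g y ∈ Q → NegligibleAt (∁ (Exited Q)) y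
    ¬exited-negligible {Q} tracks {y} gy∈Q k with exits-or-stays y
    -- All points near y are in `Exited Q`, so nothing is left to cover and any slivers do.
    ... | inj₁ (m , exits) = p (suc m) , λ n p≤n → k ℕ.+ n , ℕ.≤-refl , const y ,
      λ (¬exited , y′∈N) → contradiction (exited-local Q m (∈N⇒agree n y′∈N) p≤n exits gy∈Q) ¬exited
    ... | inj₂ stays with l , z∈Q ← tracks (subst Q (g-stays stays) gy∈Q) =
      -- The bracket yields m ≥ l, so that `z` takes values in Q, and m ≥ k, so that m + `p (suc m)`
      -- ≥ k + n.
      suc (p (l ℕ.⊔ k)) , λ n p<n →
        let m , l⊔k≤m , pm<n , n≤p = p-bracket (l ℕ.⊔ k) n p<n in
        m ℕ.+ p (suc m) ,
        ℕ.+-mono-≤ (ℕ.m⊔n≤o⇒n≤o l k l⊔k≤m) n≤p ,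
        branches y m ,
        λ (¬exited , y′∈N) → covered-by-branches m
          (agree-off-branching {Q} stays z∈Q (ℕ.m⊔n≤o⇒m≤o l k l⊔k≤m) pm<n (∈N⇒agree n y′∈N) ¬exited)

  -- Measurability of B and the conclusion

  Fσ-preimage-measurable : ∀ {A f} → Fσ A → Continuous f → Measurable (f ⊢ A)
  Fσ-preimage-measurable {A} {f} (F , closedF , A⊆F , F⊆A) contf =
    resp-≐ (F⊆A , A⊆F) (union λ n →
      resp-≐ ((λ ¬¬x∈F → byContradiction ¬¬x∈F) , λ x∈F x∉F → x∉F x∈F)
        (complement (fromOpen (contf (closedF n)))))

theorem5p3 : ExcludedMiddle 0ℓ → (A : Subset) → Δ⁰₂ A →
    Σ[ B ∈ Subset ] B ≡W A × Dualistic B ×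
    (Σ[ C ∈ Subset ] Σ[ U ∈ Subset ] Closed C × Open U × B ≐ Φ C × B ≐ Φ U)
theorem5p3 em A Δ⁰₂A@(FσA , _) with z , z∈N , tracksA , tracks∁A ← Classical.Δ⁰₂-approximation em Δ⁰₂A =
  B , ((g , g-continuous , id , id) , code , code-continuous , A≐code⊢B) ,
  (Fσ-preimage-measurable FσA g-continuous , dual) ,
  C , U , closedC , exited-open A , B≐Φ {C} U⊆C id , B≐Φ {U} id U⊆C
  where
  open Classical em
  open Retraction z z∈N

  B = g ⊢ A
  U = Exited A
  C = ∁ (Exited (∁ A))

  U⊆C : U ⊆ C
  U⊆C (_ , gy∈A) (_ , gy∉A) = gy∉A gy∈A

  closedC : Closed C
  closedC ¬¬y = map₂ (λ N⊆ y∈N ¬y → ¬y (N⊆ y∈N)) (exited-open (∁ A) (byContradiction ¬¬y))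

  A≐code⊢B : A ≐ (code ⊢ B)
  A≐code⊢B =
    (λ {x} x∈A → subst A (sym (g-stays (¬leaves-code x))) (Δ⁰₂-resp-≗ Δ⁰₂A (sym ∘ decode-code x) x∈A)) ,
    (λ {x} gcx∈A → Δ⁰₂-resp-≗ Δ⁰₂A (decode-code x) (subst A (g-stays (¬leaves-code x)) gcx∈A))

  -- B, C and U all lie between U and C and share one argument: at points of B already U has density
  -- 1, and at all others already C has density 0.
  density-1 : ∀ {S y} → U ⊆ S → y ∈ B → HasDensity S y 1ℚ
  density-1 {S} U⊆S y∈B = negligible⇒density-1 {S}
    (negligible-antitone (λ y∉S y∈U → y∉S (U⊆S y∈U)) (¬exited-negligible {A} tracksA y∈B))

  density-0 : ∀ {S y} → S ⊆ C → y ∉ B → HasDensity S y 0ℚ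
  density-0 S⊆C y∉B = negligible⇒density-0 (negligible-antitone S⊆C (¬exited-negligible {∁ A} tracks∁A y∉B))

  B≐Φ : ∀ {S} → U ⊆ S → S ⊆ C → B ≐ Φ S
  B≐Φ {S} U⊆S S⊆C = density-1 {S} U⊆S , λ {y} d₁ → byContradiction λ y∉B → density-0∧1⇒⊥ {S} {y} (density-0 {S} S⊆C y∉B) d₁

  dual : ∀ y → HasDensity B y 0ℚ ⊎ HasDensity B y 1ℚ
  dual y with em {y ∈ B}
  ... | yes y∈B = inj₂ (density-1 {B} proj₂ y∈B)
  ... | no  y∉B = inj₁ (density-0 {B} (λ y∈B (_ , y∉B) → y∉B y∈B) y∉B)
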